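{- Let $V$ be a set of $n$ vertices and let $\mathcal{T}$ be a set (so no repeated members) of triangles on $V$ having no rainbow triangle. Then $|\mathcal{T}| \le \frac{n^2}{8}$.
   Context: A triangle on $V$ is a $3$-element subset $\{x,y,z\}\subseteq V$, identified with its edge set $\{\{x,y\},\{y,z\},\{x,z\}\}$. For a family $\mathcal{T}$ of triangles, a rainbow triangle is a triangle $\{x,y,z\}$ on $V$ together with three distinct members $t_1,t_2,t_3$ of $\mathcal{T}$ (distinct as members of the family) such that $\{x,y\}$ is an edge of $t_1$, $\{y,z\}$ is an edge of $t_2$ and $\{x,z\}$ is an edge of $t_3$. In other words, the three edges of $\{x,y,z\}$ can be taken, each from a different member of $\mathcal{T}$. -}

module Defs where

open import Data.Fin.Base using (Fin)
open import Data.Fin.Subset using (Subset; _∈_; ∣_∣)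
open import Data.Nat.Base using (ℕ)
open import Data.Product.Base using (_×_)
open import Relation.Binary.PropositionalEquality.Core using (_≡_; _≢_)

record Triangle (n : ℕ) : Set where
  constructor triangle
  field
    vertices : Subset n
    size     : ∣ vertices ∣ ≡ 3

open Triangle public

-- The edges of a triangle are exactly the pairs of distinct vertices of it.
IsEdgeOf : ∀ {n} → Fin n → Fin n → Triangle n → Set
IsEdgeOf x y t = x ≢ y × x ∈ vertices t × y ∈ vertices t

-- An indexed family: its members are told apart by their indices, and it has
-- m of them. A set of m triangles is such a family that is injective.
Family : ℕ → ℕ → Set
Family m n = Fin m → Triangle n

-- The triangle {x , y , z} need not itself belong to the family.
record RainbowTriangle {m n : ℕ} (𝒯 : Family m n) : Set where
  field
    x y z    : Fin n
    x≢y      : x ≢ y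
    y≢z      : y ≢ z
    x≢z      : x ≢ z
    t₁ t₂ t₃ : Fin m
    t₁≢t₂    : t₁ ≢ t₂
    t₂≢t₃    : t₂ ≢ t₃
    t₁≢t₃    : t₁ ≢ t₃
    xy∈t₁    : IsEdgeOf x y (𝒯 t₁)
    yz∈t₂    : IsEdgeOf y z (𝒯 t₂)
    xz∈t₃    : IsEdgeOf x z (𝒯 t₃)

{-# OPTIONS --safe #-}

-- If two edges of a member t lay in further members, these two members would be
-- distinct (a common one would contain the vertices of t, hence equal t), and
-- together with t they would give a rainbow triangle. So every member t has an
-- apex: a vertex whose two edges in t lie in no other member. These 2m edges form
-- a triangle-free graph: a triangle in it would be rainbow unless two of its edges
-- have the same owner, but then that member owns all three edges, and its apex
-- would lie on each of them. By Mantel's theorem 2m ≤ n² / 4.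
module Submission where

open import Defs
open import Data.Empty using (⊥)
open import Data.Fin.Base using (Fin; zero; suc; punchIn; punchOut; remQuot; combine)
open import Data.Fin.Patterns using (0F; 1F; 2F)
open import Data.Fin.Properties
  using (_≟_; any?; suc-injective; punchInᵢ≢i; punchIn-injective; punchIn-punchOut; combine-remQuot)
open import Data.Fin.Subset using (Subset; inside; outside; _∈_; _⊆_; ∣_∣)
open import Data.Fin.Subset.Properties using (_∈?_; ⊆-antisym; p⊂q⇒∣p∣<∣q∣)
open import Data.Integer.Base using (+_; +≤+)
import Data.Integer.Base as ℤ
import Data.Integer.Properties as ℤ
open import Data.Nat.Base using (ℕ; zero; suc; _+_; _*_; _^_; z≤n)
import Data.Nat.Base as ℕ
open import Data.Nat.Properties
  using ( +-*-semiring; +-mono-≤; +-monoˡ-≤; +-cancelˡ-≤; *-monoʳ-≤; *-cancelˡ-≤; *-identityʳ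
        ; *-zeroʳ; m≤m+n; m≤n+m; ≤-refl; ≤-reflexive; ≤-trans; ≤-total; ≡-irrelevant
        ; <-irrefl; m≤n⇒∃[o]m+o≡n; module ≤-Reasoning)
open import Data.Nat.Tactic.RingSolver using (solve-∀)
open import Data.Product.Base using (∃; _×_; _,_; proj₁; proj₂; uncurry)
open import Data.Product.Properties using (≡-dec; ,-injectiveˡ; ,-injectiveʳ)
open import Data.Rational.Base using (_/_; _≤_)
open import Data.Rational.Properties using (toℚᵘ-cancel-≤; toℚᵘ-fromℚᵘ)
import Data.Rational.Unnormalised.Base as ℚᵘ
import Data.Rational.Unnormalised.Properties as ℚᵘ
open import Data.Sum.Base using (_⊎_; inj₁; inj₂; swap)
open import Data.Vec.Base using ([]; _∷_; here; there)
open import Data.Vec.Functional using (Vector)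
open import Function.Base using (_∘_; const)
open import Function.Definitions using (Injective)
open import Relation.Binary.Definitions using (Decidable; Symmetric)
open import Relation.Binary.PropositionalEquality
  using (_≡_; _≢_; refl; sym; trans; cong; cong₂; subst; subst₂; ≢-sym; module ≡-Reasoning)
open import Relation.Nullary.Decidable using (Dec; yes; no; _×-dec_; _⊎-dec_; ¬?)
open import Relation.Nullary.Negation using (contradiction)
open import Relation.Nullary.Negation.Core using (¬_)
open import Algebra.Properties.Semiring.Sum +-*-semiring
  using (sum; sum-cong-≗; ∑-distrib-+; ∑-comm; *-distribˡ-sum; *-distribʳ-sum)

-- Finite sums and indicator values of decidable propositions.

sum-mono : ∀ {n} {f g : Vector ℕ n} → (∀ i → f i ℕ.≤ g i) → sum f ℕ.≤ sum g
sum-mono {zero}  f≤g = z≤n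
sum-mono {suc n} f≤g = +-mono-≤ (f≤g zero) (sum-mono (f≤g ∘ suc))

sum-const : ∀ n c → sum {n} (const c) ≡ n * c
sum-const zero    c = refl
sum-const (suc n) c = cong (_+_ c) (sum-const n c)

term≤sum : ∀ {n} (f : Vector ℕ n) i → f i ℕ.≤ sum f
term≤sum f zero    = m≤m+n _ _
term≤sum f (suc i) = ≤-trans (term≤sum (f ∘ suc) i) (m≤n+m _ _)

χ : ∀ {p} {P : Set p} → Dec P → ℕ
χ (yes _) = 1
χ (no  _) = 0

χ-yes : ∀ {p} {P : Set p} (P? : Dec P) → P → χ P? ≡ 1
χ-yes (yes _) p = refl
χ-yes (no ¬p) p = contradiction p ¬p

χ-no : ∀ {p} {P : Set p} (P? : Dec P) → ¬ P → χ P? ≡ 0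
χ-no (yes p) ¬p = contradiction p ¬p
χ-no (no _)  ¬p = refl

χ-disjoint : ∀ {p q} {P : Set p} {Q : Set q} (P? : Dec P) (Q? : Dec Q) →
             (P → Q → ⊥) → χ P? + χ Q? ℕ.≤ 1
χ-disjoint (yes p) Q?      P∦Q = ≤-reflexive (cong suc (χ-no Q? (P∦Q p)))
χ-disjoint (no _)  (yes _) P∦Q = ≤-refl
χ-disjoint (no _)  (no _)  P∦Q = z≤n

-- By uniqueness at most one summand is 1, and a witness for it also proves `Q`.
sum-χ≤χ : ∀ {n p q} {P : Fin n → Set p} {Q : Set q} (P? : ∀ i → Dec (P i)) (Q? : Dec Q) →
          (∀ {i j} → P i → P j → i ≡ j) → (∀ {i} → P i → Q) → sum (λ i → χ (P? i)) ℕ.≤ χ Q?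
sum-χ≤χ {zero}  P? Q? unique P→Q = z≤n
sum-χ≤χ {suc n} P? Q? unique P→Q with P? zero
... | no  _  = sum-χ≤χ (P? ∘ suc) Q? (λ p q → suc-injective (unique p q)) P→Q
... | yes p₀ = begin
  suc (sum (λ i → χ (P? (suc i))))  ≡⟨ cong suc (sum-cong-≗ λ i → χ-no (P? (suc i)) (λ p → contradiction (unique p₀ p) λ ())) ⟩
  suc (sum {n} (const 0))           ≡⟨ cong suc (trans (sum-const n 0) (*-zeroʳ n)) ⟩
  1                                 ≡⟨ χ-yes Q? (P→Q p₀) ⟨
  χ Q?                              ∎
  where open ≤-Reasoning

-- Counting the ordered pairs in a relation.

module _ {n : ℕ} {R : Fin n → Fin n → Set} (R? : Decidable R) where

  #pairs : ℕ
  #pairs = sum λ u → sum λ v → χ (R? u v)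

  -- Double counting of the incidences `f k ≡ (u , v)`: every `k` has at least one, while a pair has
  -- at most one since `f` is injective, and none outside `R`.
  injective⇒≤#pairs : ∀ {N} (f : Fin N → Fin n × Fin n) → Injective _≡_ _≡_ f →
                      (∀ k → R (proj₁ (f k)) (proj₂ (f k))) → N ℕ.≤ #pairs
  injective⇒≤#pairs {N} f f-inj f∈R = begin
    N                                            ≡⟨ *-identityʳ N ⟨
    N * 1                                        ≡⟨ sum-const N 1 ⟨
    sum {N} (const 1)                            ≤⟨ sum-mono hit ⟩
    sum (λ k → sum λ u → sum λ v → χ (at k u v)) ≡⟨ ∑-comm (λ k u → sum λ v → χ (at k u v)) ⟩
    sum (λ u → sum λ k → sum λ v → χ (at k u v)) ≡⟨ sum-cong-≗ (λ u → ∑-comm (λ k v → χ (at k u v))) ⟩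
    sum (λ u → sum λ v → sum λ k → χ (at k u v)) ≤⟨ sum-mono (λ u → sum-mono λ v → sum-χ≤χ (λ k → at k u v) (R? u v)
                                                      (λ p q → f-inj (trans p (sym q)))
                                                      (λ { {k} refl → f∈R k })) ⟩
    #pairs                                       ∎
    where
    open ≤-Reasoning
    at : ∀ k u v → Dec (f k ≡ (u , v))
    at k u v = ≡-dec _≟_ _≟_ (f k) (u , v)
    hit : ∀ k → 1 ℕ.≤ sum λ u → sum λ v → χ (at k u v)
    hit k = begin
      1                                    ≡⟨ χ-yes (at k _ _) refl ⟨
      χ (at k (proj₁ (f k)) (proj₂ (f k))) ≤⟨ term≤sum (λ v → χ (at k (proj₁ (f k)) v)) _ ⟩
      sum (λ v → χ (at k (proj₁ (f k)) v)) ≤⟨ term≤sum (λ u → sum λ v → χ (at k u v)) _ ⟩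
      sum (λ u → sum λ v → χ (at k u v))   ∎

-- Mantel's theorem, by summing degrees over adjacent pairs.

2ab≤a²+b² : ∀ a b → 2 * (a * b) ℕ.≤ a * a + b * b
2ab≤a²+b² a b with ≤-total a b
-- Writing the larger number as the smaller plus `k` avoids truncated subtraction; the two sides
-- then differ by exactly `k * k`.
... | inj₁ a≤b with k , refl ← m≤n⇒∃[o]m+o≡n a≤b =
  ≤-trans (m≤m+n _ (k * k)) (≤-reflexive (identity a k))
  where
  identity : ∀ a k → 2 * (a * (a + k)) + k * k ≡ a * a + (a + k) * (a + k)
  identity = solve-∀
... | inj₂ b≤a with k , refl ← m≤n⇒∃[o]m+o≡n b≤a =
  ≤-trans (m≤m+n _ (k * k)) (≤-reflexive (identity b k))
  where
  identity : ∀ b k → 2 * ((b + k) * b) + k * k ≡ (b + k) * (b + k) + b * b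
  identity = solve-∀

module _ {n : ℕ} {R : Fin n → Fin n → Set} (R? : Decidable R) (R-sym : Symmetric R)
         (triangle-free : ∀ {u v w} → R u v → R v w → R u w → ⊥) where

  private
    A : Fin n → Fin n → ℕ
    A u v = χ (R? u v)

    deg : Fin n → ℕ
    deg u = sum (A u)

    D Q : ℕ
    D = sum deg
    Q = sum λ u → deg u * deg u

    A-sym : ∀ u v → A u v ≡ A v u
    A-sym u v with R? u v
    ... | yes r = sym (χ-yes (R? v u) (R-sym r))
    ... | no ¬r = sym (χ-no (R? v u) (¬r ∘ R-sym))

    -- Adjacent vertices have no common neighbour, so their neighbourhoods are disjoint. The factor
    -- `A u v` replaces the hypothesis of adjacency, so that the inequality can be summed over all
    -- pairs.
    adjacent-degrees : ∀ u v → A u v * (deg u + deg v) ℕ.≤ A u v * n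
    adjacent-degrees u v with R? u v
    ... | no _  = z≤n
    ... | yes r = *-monoʳ-≤ 1 (begin
      deg u + deg v              ≡⟨ ∑-distrib-+ (A u) (A v) ⟨
      sum (λ w → A u w + A v w)  ≤⟨ sum-mono (λ w → χ-disjoint (R? u w) (R? v w) λ p q → triangle-free r q p) ⟩
      sum {n} (const 1)          ≡⟨ sum-const n 1 ⟩
      n * 1                      ≡⟨ *-identityʳ n ⟩
      n                          ∎)
      where open ≤-Reasoning

    weight-by-first : sum (λ u → sum λ v → A u v * deg u) ≡ Q
    weight-by-first = sum-cong-≗ λ u → sym (*-distribʳ-sum (deg u) (A u))

    weight-by-second : sum (λ u → sum λ v → A u v * deg v) ≡ Q
    weight-by-second = begin
      sum (λ u → sum λ v → A u v * deg v)  ≡⟨ ∑-comm (λ u v → A u v * deg v) ⟩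
      sum (λ v → sum λ u → A u v * deg v)  ≡⟨ sum-cong-≗ (λ v → sum-cong-≗ λ u → cong (_* deg v) (A-sym u v)) ⟩
      sum (λ v → sum λ u → A v u * deg v)  ≡⟨ weight-by-first ⟩
      Q                                    ∎
      where open ≡-Reasoning

    -- This is `adjacent-degrees` summed over all ordered pairs. In either position a vertex `u`
    -- occurs once per neighbour and thus contributes `deg u * deg u`.
    2Q≤Dn : Q + Q ℕ.≤ D * n
    2Q≤Dn = begin
      Q + Q
        ≡⟨ cong₂ _+_ weight-by-first weight-by-second ⟨
      sum (λ u → sum λ v → A u v * deg u) + sum (λ u → sum λ v → A u v * deg v)
        ≡⟨ ∑-distrib-+ (λ u → sum λ v → A u v * deg u) (λ u → sum λ v → A u v * deg v) ⟨
      sum (λ u → sum (λ v → A u v * deg u) + sum (λ v → A u v * deg v))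
        ≡⟨ sum-cong-≗ (λ u → ∑-distrib-+ (λ v → A u v * deg u) (λ v → A u v * deg v)) ⟨
      sum (λ u → sum λ v → A u v * deg u + A u v * deg v)
        ≡⟨ sum-cong-≗ (λ u → sum-cong-≗ λ v → distrib (A u v) (deg u) (deg v)) ⟩
      sum (λ u → sum λ v → A u v * (deg u + deg v))
        ≤⟨ sum-mono (λ u → sum-mono (adjacent-degrees u)) ⟩
      sum (λ u → sum λ v → A u v * n)
        ≡⟨ sum-cong-≗ (λ u → *-distribʳ-sum n (A u)) ⟨
      sum (λ u → deg u * n)
        ≡⟨ *-distribʳ-sum n deg ⟨
      D * n ∎
      where
      open ≤-Reasoning
      distrib : ∀ a b c → a * b + a * c ≡ a * (b + c)
      distrib = solve-∀

    4nD≤4Q+n³ : (4 * n) * D ℕ.≤ 4 * Q + n * (n * n)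
    4nD≤4Q+n³ = begin
      (4 * n) * D                                      ≡⟨ *-distribˡ-sum (4 * n) deg ⟩
      sum (λ u → (4 * n) * deg u)                      ≤⟨ sum-mono (λ u → am-gm (deg u)) ⟩
      sum (λ u → 4 * (deg u * deg u) + n * n)          ≡⟨ ∑-distrib-+ (λ u → 4 * (deg u * deg u)) (const (n * n)) ⟩
      sum (λ u → 4 * (deg u * deg u)) + sum {n} (const (n * n))
        ≡⟨ cong₂ _+_ (sym (*-distribˡ-sum 4 (λ u → deg u * deg u))) (sum-const n (n * n)) ⟩
      4 * Q + n * (n * n)                              ∎
      where
      open ≤-Reasoning
      lhs : ∀ n d → (4 * n) * d ≡ 2 * ((2 * d) * n)
      lhs = solve-∀
      rhs : ∀ n d → (2 * d) * (2 * d) + n * n ≡ 4 * (d * d) + n * n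
      rhs = solve-∀
      am-gm : ∀ d → (4 * n) * d ℕ.≤ 4 * (d * d) + n * n
      am-gm d = begin
        (4 * n) * d                ≡⟨ lhs n d ⟩
        -- Comparing `2 * d` with `n` is tight when `d` is half of `n`, as in a balanced complete
        -- bipartite graph.
        2 * ((2 * d) * n)          ≤⟨ 2ab≤a²+b² (2 * d) n ⟩
        (2 * d) * (2 * d) + n * n  ≡⟨ rhs n d ⟩
        4 * (d * d) + n * n        ∎

    -- Summing 2 (2d) n ≤ (2d)² + n² over the degrees d gives 4nD ≤ 4Q + n³, and 4Q ≤ 2Dn.
    n[2D]≤n[n²] : n * (2 * D) ℕ.≤ n * (n * n)
    n[2D]≤n[n²] = +-cancelˡ-≤ (2 * (D * n)) _ _ (begin
      2 * (D * n) + n * (2 * D)  ≡⟨ lhs n D ⟩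
      (4 * n) * D                ≤⟨ 4nD≤4Q+n³ ⟩
      4 * Q + n * (n * n)        ≡⟨ cong (_+ n * (n * n)) (rhs Q) ⟩
      2 * (Q + Q) + n * (n * n)  ≤⟨ +-monoˡ-≤ (n * (n * n)) (*-monoʳ-≤ 2 2Q≤Dn) ⟩
      2 * (D * n) + n * (n * n)  ∎)
      where
      open ≤-Reasoning
      lhs : ∀ n d → 2 * (d * n) + n * (2 * d) ≡ (4 * n) * d
      lhs = solve-∀
      rhs : ∀ q → 4 * q ≡ 2 * (q + q)
      rhs = solve-∀

  -- Since `#pairs R?` counts each edge in both directions, this is the usual bound of n² / 4 on the
  -- number of edges.
  mantel : 2 * #pairs R? ℕ.≤ n * n
  -- The factor `n` can be cancelled only if it is nonzero; for `n = 0` the sum is empty and the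
  -- bound reads 0 ≤ 0.
  mantel = cancel-n n n[2D]≤n[n²] (λ { refl → z≤n })
    where
    cancel-n : ∀ k {a b} → k * a ℕ.≤ k * b → (k ≡ 0 → a ℕ.≤ b) → a ℕ.≤ b
    cancel-n zero    _     base = base refl
    cancel-n (suc k) ka≤kb _    = *-cancelˡ-≤ (suc k) ka≤kb

-- Decoding of indices, enumeration of subsets, equality of triangles.

remQuot-injective : ∀ {m} n → Injective _≡_ _≡_ (remQuot {m} n)
remQuot-injective {m} n {x} {y} eq = begin
  x                                  ≡⟨ combine-remQuot {m} n x ⟨
  uncurry combine (remQuot {m} n x)  ≡⟨ cong (uncurry combine) eq ⟩
  uncurry combine (remQuot {m} n y)  ≡⟨ combine-remQuot {m} n y ⟩
  y                                  ∎
  where open ≡-Reasoning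

-- The length `k` is kept apart from `∣ p ∣` so that it can be transported along `size`, which makes
-- `Fin 3` the labels of the corners of a triangle.
record Enumeration {n : ℕ} (p : Subset n) (k : ℕ) : Set where
  field
    elem      : Fin k → Fin n
    injective : Injective _≡_ _≡_ elem
    member    : ∀ i → elem i ∈ p
    cover     : ∀ {x} → x ∈ p → ∃ λ i → elem i ≡ x

enumerate : ∀ {n} (p : Subset n) → Enumeration p ∣ p ∣
enumerate []            = record
  { elem = λ () ; injective = λ { {()} } ; member = λ () ; cover = λ () }
enumerate (outside ∷ p) = record
  { elem      = suc ∘ elem
  ; injective = injective ∘ suc-injective
  ; member    = there ∘ member
  ; cover     = λ { (there x∈p) → let i , eq = cover x∈p in i , cong suc eq }
  }
  where open Enumeration (enumerate p)
enumerate (inside ∷ p)  = record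
  { elem      = λ { zero → zero ; (suc i) → suc (elem i) }
  ; injective = λ { {zero} {zero} _ → refl ; {suc _} {suc _} eq → cong suc (injective (suc-injective eq)) }
  ; member    = λ { zero → here ; (suc i) → there (member i) }
  ; cover     = λ { here → zero , refl ; (there x∈p) → let i , eq = cover x∈p in suc i , cong suc eq }
  }
  where open Enumeration (enumerate p)

⊆∧∣∣≡⇒≡ : ∀ {n} {p q : Subset n} → p ⊆ q → ∣ p ∣ ≡ ∣ q ∣ → p ≡ q
⊆∧∣∣≡⇒≡ {p = p} {q} p⊆q ∣p∣≡∣q∣ = ⊆-antisym p⊆q q⊆p
  where
  q⊆p : q ⊆ p
  q⊆p {x} x∈q with x ∈? p
  ... | yes x∈p = x∈p
  ... | no  x∉p = contradiction (p⊂q⇒∣p∣<∣q∣ (p⊆q , x , x∈q , x∉p)) (<-irrefl ∣p∣≡∣q∣)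

-- Both sets have three elements, so the inclusion is an equality; the `size` proofs agree because
-- equality proofs in `ℕ` are unique.
vertices-⊆⇒≡ : ∀ {n} {s t : Triangle n} → vertices s ⊆ vertices t → s ≡ t
vertices-⊆⇒≡ {s = triangle p ∣p∣≡3} {triangle q ∣q∣≡3} p⊆q
  with refl ← ⊆∧∣∣≡⇒≡ p⊆q (trans ∣p∣≡3 (sym ∣q∣≡3)) = cong (triangle p) (≡-irrelevant _ _)

-- Shared edges and the choice of an apex.

module _ {m n : ℕ} (𝒯 : Family m n) (𝒯-inj : Injective _≡_ _≡_ 𝒯) (no-rainbow : ¬ RainbowTriangle 𝒯) where

  private
    corners : ∀ i → Enumeration (vertices (𝒯 i)) 3
    corners i = subst (Enumeration _) (size (𝒯 i)) (enumerate (vertices (𝒯 i)))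

    module Corner i = Enumeration (corners i)
    open Corner using () renaming (elem to corner)

    Shared : Fin m → Fin 3 → Fin 3 → Set
    Shared i a b = ∃ λ j → j ≢ i × corner i a ∈ vertices (𝒯 j) × corner i b ∈ vertices (𝒯 j)

    shared? : ∀ i a b → Dec (Shared i a b)
    shared? i a b = any? λ j →
      ¬? (j ≟ i) ×-dec (corner i a ∈? vertices (𝒯 j)) ×-dec (corner i b ∈? vertices (𝒯 j))

    shared-sym : ∀ {i a b} → Shared i a b → Shared i b a
    shared-sym (j , j≢i , a∈ , b∈) = j , j≢i , b∈ , a∈

    -- Two edges of a triangle always meet in a corner `a`, and `punchIn a 0F` and `punchIn a 1F`
    -- label the other two corners, so this form covers every pair of edges.
    shared-once : ∀ i a → Shared i a (punchIn a 0F) → Shared i a (punchIn a 1F) → ⊥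
    shared-once i a (j , j≢i , a∈j , b∈j) (k , k≢i , a∈k , c∈k) with j ≟ k
    ... | yes refl = j≢i (sym (𝒯-inj (vertices-⊆⇒≡ i⊆j)))
      where
      corner∈j : ∀ d → corner i d ∈ vertices (𝒯 j)
      corner∈j d with a ≟ d
      ... | yes refl = a∈j
      ... | no a≢d with punchOut a≢d | punchIn-punchOut a≢d
      ...   | 0F | refl = b∈j
      ...   | 1F | refl = c∈k
      i⊆j : vertices (𝒯 i) ⊆ vertices (𝒯 j)
      i⊆j x∈i with d , refl ← Corner.cover i x∈i = corner∈j d
    ... | no j≢k = no-rainbow record
      -- The triangle is the member `i` itself: its edges at `a` come from `j` and `k`, and `i`
      -- supplies the edge opposite `a`.
      { x = corner i (punchIn a 0F) ; y = corner i a ; z = corner i (punchIn a 1F)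
      ; x≢y = b≢a ; y≢z = ≢-sym c≢a ; x≢z = b≢c
      ; t₁ = j ; t₂ = k ; t₃ = i
      ; t₁≢t₂ = j≢k ; t₂≢t₃ = k≢i ; t₁≢t₃ = j≢i
      ; xy∈t₁ = b≢a , b∈j , a∈j
      ; yz∈t₂ = ≢-sym c≢a , a∈k , c∈k
      ; xz∈t₃ = b≢c , Corner.member i _ , Corner.member i _
      }
      where
      b≢a : corner i (punchIn a 0F) ≢ corner i a
      b≢a = punchInᵢ≢i a 0F ∘ Corner.injective i
      c≢a : corner i (punchIn a 1F) ≢ corner i a
      c≢a = punchInᵢ≢i a 1F ∘ Corner.injective i
      b≢c : corner i (punchIn a 0F) ≢ corner i (punchIn a 1F)
      b≢c eq = contradiction (punchIn-injective a 0F 1F (Corner.injective i eq)) λ ()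

    -- If one of the edges 01 and 02 is shared, the corner opposite it works, as `shared-once`
    -- excludes a second shared edge. Otherwise corner 0 works, whether or not the edge 12 is
    -- shared.
    apex-label : ∀ i → ∃ λ a → ∀ k → ¬ Shared i a (punchIn a k)
    apex-label i with shared? i 0F 1F | shared? i 0F 2F
    ... | yes s₀₁ | _       = 2F , λ
      { 0F s → shared-once i 0F s₀₁ (shared-sym s)
      ; 1F s → shared-once i 1F (shared-sym s₀₁) (shared-sym s) }
    ... | no ¬s₀₁ | yes s₀₂ = 1F , λ
      { 0F s → ¬s₀₁ (shared-sym s)
      ; 1F s → shared-once i 2F (shared-sym s₀₂) (shared-sym s) }
    ... | no ¬s₀₁ | no ¬s₀₂ = 0F , λ { 0F → ¬s₀₁ ; 1F → ¬s₀₂ }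

    apex : Fin m → Fin n
    apex i = corner i (proj₁ (apex-label i))

    base : Fin m → Fin 2 → Fin n
    base i k = corner i (punchIn (proj₁ (apex-label i)) k)

    apex∈ : ∀ i → apex i ∈ vertices (𝒯 i)
    apex∈ i = Corner.member i _

    base∈ : ∀ i k → base i k ∈ vertices (𝒯 i)
    base∈ i k = Corner.member i _

    base≢apex : ∀ i k → base i k ≢ apex i
    base≢apex i k = punchInᵢ≢i _ k ∘ Corner.injective i

    base-injective : ∀ i {k l} → base i k ≡ base i l → k ≡ l
    base-injective i = punchIn-injective _ _ _ ∘ Corner.injective i

    base-cover : ∀ i {x} → x ∈ vertices (𝒯 i) → x ≢ apex i → ∃ λ k → base i k ≡ x
    base-cover i x∈ x≢ with d , refl ← Corner.cover i x∈ =
      punchOut a≢d , cong (corner i) (punchIn-punchOut a≢d)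
      where
      a≢d : proj₁ (apex-label i) ≢ d
      a≢d = x≢ ∘ sym ∘ cong (corner i)

    base-private : ∀ i k {j} → apex i ∈ vertices (𝒯 j) → base i k ∈ vertices (𝒯 j) → j ≡ i
    base-private i k {j} a∈ b∈ with j ≟ i
    ... | yes eq = eq
    ... | no j≢i = contradiction (j , j≢i , a∈ , b∈) (proj₂ (apex-label i) k)

    -- The graph of spokes, the edges at the apices, and its lack of triangles.

    SpokeOf : Fin m → Fin n → Fin n → Set
    SpokeOf i u v = IsEdgeOf u v (𝒯 i) × (u ≡ apex i ⊎ v ≡ apex i)

    Spoke : Fin n → Fin n → Set
    Spoke u v = ∃ λ i → SpokeOf i u v

    spoke? : Decidable Spoke
    spoke? u v = any? λ i →
      (¬? (u ≟ v) ×-dec (u ∈? vertices (𝒯 i)) ×-dec (v ∈? vertices (𝒯 i)))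
      ×-dec ((u ≟ apex i) ⊎-dec (v ≟ apex i))

    spokeOf-sym : ∀ {i u v} → SpokeOf i u v → SpokeOf i v u
    spokeOf-sym ((u≢v , u∈ , v∈) , apex-end) = (≢-sym u≢v , v∈ , u∈) , swap apex-end

    -- One end of a spoke is the apex and the other must be a base vertex, and the apex was chosen
    -- so that no other member contains both.
    spoke-private : ∀ {i j u v} → SpokeOf i u v → u ∈ vertices (𝒯 j) → v ∈ vertices (𝒯 j) → j ≡ i
    spoke-private {i} ((u≢v , _ , v∈i) , inj₁ refl) u∈j v∈j
      with k , refl ← base-cover i v∈i (≢-sym u≢v) = base-private i k u∈j v∈j
    spoke-private s@(_ , inj₂ refl) u∈j v∈j with ((v≢u , _ , u∈i) , _) ← spokeOf-sym s
      with k , refl ← base-cover _ u∈i (≢-sym v≢u) = base-private _ k v∈j u∈j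

    -- All three edges would contain the apex, but no vertex lies on all three edges of a triangle;
    -- hence two of its vertices would coincide.
    no-spoke-triangle-in-member : ∀ {i u v w} → SpokeOf i u v → SpokeOf i v w → SpokeOf i u w → ⊥
    no-spoke-triangle-in-member ((u≢v , _) , inj₁ refl) (_ , inj₁ v≡a) _ = u≢v (sym v≡a)
    no-spoke-triangle-in-member (_ , inj₁ refl) (_ , inj₂ w≡a) ((u≢w , _) , _) = u≢w (sym w≡a)
    no-spoke-triangle-in-member ((u≢v , _) , inj₂ refl) _ (_ , inj₁ u≡a) = u≢v u≡a
    no-spoke-triangle-in-member (_ , inj₂ refl) ((v≢w , _) , _) (_ , inj₂ w≡a) = v≢w (sym w≡a)

    spokes-triangle-free : ∀ {u v w} → Spoke u v → Spoke v w → Spoke u w → ⊥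
    spokes-triangle-free {u} {v} {w}
      (i , s@((u≢v , u∈i , v∈i) , _)) (j , t@((v≢w , v∈j , w∈j) , _)) (k , r@((u≢w , u∈k , w∈k) , _))
      with i ≟ j | j ≟ k | i ≟ k
    -- A member that owns two of the edges contains `u`, `v` and `w`, so by `spoke-private` it owns
    -- the third edge as well.
    ... | yes refl | _ | _ with refl ← spoke-private r u∈i w∈j = no-spoke-triangle-in-member s t r
    ... | no _ | yes refl | _ with refl ← spoke-private s u∈k v∈j = no-spoke-triangle-in-member s t r
    ... | no _ | no _ | yes refl with refl ← spoke-private t v∈i w∈k = no-spoke-triangle-in-member s t r
    ... | no i≢j | no j≢k | no i≢k = no-rainbow record
      { x = u ; y = v ; z = w
      ; x≢y = u≢v ; y≢z = v≢w ; x≢z = u≢w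
      ; t₁ = i ; t₂ = j ; t₃ = k
      ; t₁≢t₂ = i≢j ; t₂≢t₃ = j≢k ; t₁≢t₃ = i≢k
      ; xy∈t₁ = u≢v , u∈i , v∈i
      ; yz∈t₂ = v≢w , v∈j , w∈j
      ; xz∈t₃ = u≢w , u∈k , w∈k
      }

    -- Darts, the oriented spokes, and their number.

    dart : Fin m → Fin 2 → Fin 2 → Fin n × Fin n
    dart i k 0F = apex i , base i k
    dart i k 1F = base i k , apex i

    dart-spokeOf : ∀ i k o → SpokeOf i (proj₁ (dart i k o)) (proj₂ (dart i k o))
    dart-spokeOf i k 0F = (≢-sym (base≢apex i k) , apex∈ i , base∈ i k) , inj₁ refl
    dart-spokeOf i k 1F = spokeOf-sym (dart-spokeOf i k 0F)

    dart-owner : ∀ i j k l o o′ → dart i k o ≡ dart j l o′ → i ≡ j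
    dart-owner i j k l o o′ eq with ((_ , u∈j , v∈j) , _) ← dart-spokeOf j l o′ =
      sym (spoke-private (dart-spokeOf i k o)
        (subst (_∈ vertices (𝒯 j)) (sym (,-injectiveˡ eq)) u∈j)
        (subst (_∈ vertices (𝒯 j)) (sym (,-injectiveʳ eq)) v∈j))

    dart-label : ∀ i k l o o′ → dart i k o ≡ dart i l o′ → (k , o) ≡ (l , o′)
    dart-label i k l 0F 0F eq = cong (_, 0F) (base-injective i (,-injectiveʳ eq))
    dart-label i k l 0F 1F eq = contradiction (sym (,-injectiveˡ eq)) (base≢apex i l)
    dart-label i k l 1F 0F eq = contradiction (,-injectiveˡ eq) (base≢apex i k)
    dart-label i k l 1F 1F eq = cong (_, 1F) (base-injective i (,-injectiveˡ eq))

    -- An index encodes a member, one of its two base vertices and an orientation. Both orientations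
    -- are listed because `#pairs` counts ordered pairs.
    nthDart : Fin (m * 4) → Fin n × Fin n
    nthDart x = let i , r = remQuot 4 x ; k , o = remQuot {2} 2 r in dart i k o

    nthDart-injective : Injective _≡_ _≡_ nthDart
    nthDart-injective {x} {y} eq = remQuot-injective 4 (pair-≡ (remQuot {m} 4 x) (remQuot {m} 4 y) eq)
      where
      dartAt : Fin m × Fin 4 → Fin n × Fin n
      dartAt (i , r) = let k , o = remQuot {2} 2 r in dart i k o
      -- Taking arbitrary pairs in place of values of `remQuot` leaves the owners as variables, so
      -- that their equality can be matched with `refl`.
      pair-≡ : ∀ p q → dartAt p ≡ dartAt q → p ≡ q
      pair-≡ (i , r) (j , s) eq with refl ← dart-owner i j _ _ _ _ eq =
        cong (i ,_) (remQuot-injective {2} 2 (dart-label i _ _ _ _ eq))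

    nthDart-spoke : ∀ x → Spoke (proj₁ (nthDart x)) (proj₂ (nthDart x))
    nthDart-spoke x =
      let i , r = remQuot {m} 4 x ; k , o = remQuot {2} 2 r in i , dart-spokeOf i k o

  8∣𝒯∣≤n² : m * 8 ℕ.≤ n * n
  8∣𝒯∣≤n² = begin
    m * 8              ≡⟨ regroup m ⟩
    2 * (m * 4)        ≤⟨ *-monoʳ-≤ 2 (injective⇒≤#pairs spoke? nthDart nthDart-injective nthDart-spoke) ⟩
    2 * #pairs spoke?  ≤⟨ mantel spoke? (λ (i , s) → i , spokeOf-sym s) spokes-triangle-free ⟩
    n * n              ∎
    where
    open ≤-Reasoning
    regroup : ∀ m → m * 8 ≡ 2 * (m * 4)
    regroup = solve-∀

-- From natural numbers to the rational bound.

/-mono-≤ : ∀ a b c d .{{_ : ℕ.NonZero b}} .{{_ : ℕ.NonZero d}} →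
           a * d ℕ.≤ c * b → (+ a) / b ≤ (+ c) / d
-- Because `_/_` reduces to lowest terms, cross-multiplication is done on unnormalised fractions;
-- `ℚᵘ.mkℚᵘ` takes the denominator minus one, hence `b` and `d`.
/-mono-≤ a (suc b) c (suc d) ad≤cb = toℚᵘ-cancel-≤ (begin
  _                     ≃⟨ toℚᵘ-fromℚᵘ (ℚᵘ.mkℚᵘ (+ a) b) ⟩
  ℚᵘ.mkℚᵘ (+ a) b       ≤⟨ ℚᵘ.*≤* (subst₂ ℤ._≤_ (ℤ.pos-* a (suc d)) (ℤ.pos-* c (suc b)) (+≤+ ad≤cb)) ⟩
  ℚᵘ.mkℚᵘ (+ c) d       ≃⟨ toℚᵘ-fromℚᵘ (ℚᵘ.mkℚᵘ (+ c) d) ⟨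
  _                     ∎)
  where
  open ℚᵘ.≤-Reasoning

theorem2p1 : ∀ (n m : ℕ) (𝒯 : Family m n) → Injective _≡_ _≡_ 𝒯 →
    ¬ RainbowTriangle 𝒯 → (+ m) / 1 ≤ (+ (n ^ 2)) / 8
theorem2p1 n m 𝒯 𝒯-inj no-rainbow = /-mono-≤ m 1 (n ^ 2) 8 (begin
  m * 8      ≤⟨ 8∣𝒯∣≤n² 𝒯 𝒯-inj no-rainbow ⟩
  n * n      ≡⟨ square n ⟩
  n ^ 2 * 1  ∎)
  where
  open ≤-Reasoning
  square : ∀ n → n * n ≡ n ^ 2 * 1
  square n = trans (cong (n *_) (sym (*-identityʳ n))) (sym (*-identityʳ (n ^ 2)))
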